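{- Let $a,b$ be positive integers, let $\{F_n(q)\}_{n\geq 0}$ be the $q$-biperiodic Fibonacci sequence and, for $s\geq 0$, let $\{F^{(s)}_n(q)\}_{n\geq 0}$ be the shifted $q$-biperiodic Fibonacci sequence. For all integers $n,m\geq 0$, $$F_{n+m+1}(q)=F_{m+1}(q)F_{n+1}^{(m)}(q) + q^mF_{m}(q)F_{n}^{(m+1)}(q).$$
   Context: Fix positive integers $a,b$; $q$ is an indeterminate. For an integer $n$, $\xi(n)=n-2\lfloor n/2\rfloor$ (so $\xi(n)=0$ if $n$ is even and $1$ if $n$ is odd). The $q$-biperiodic Fibonacci sequence is defined by $F_0(q)=0$, $F_1(q)=1$ and, for $n\geq 2$, $F_n(q)=aF_{n-1}(q)+q^{n-2}F_{n-2}(q)$ if $n$ is even, $F_n(q)=bF_{n-1}(q)+q^{n-2}F_{n-2}(q)$ if $n$ is odd. For an integer $s\geq 0$, the shifted $q$-biperiodic Fibonacci sequence is defined by $F^{(s)}_0(q)=0$, $F^{(s)}_1(q)=1$ and, for $n\geq 2$, $$F^{(s)}_{n}(q)=\begin{cases} a^{\xi(s+1)}b^{1-\xi(s+1)}F^{(s)}_{n-1}(q) + q^{n-2+s}F^{(s)}_{n-2}(q), & n \text{ even},\\ a^{1-\xi(s+1)}b^{\xi(s+1)}F^{(s)}_{n-1}(q) + q^{n-2+s}F^{(s)}_{n-2}(q), & n\text{ odd}.\end{cases}$$ -}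

module Defs where

open import Algebra.Bundles.Raw using (RawSemiring)
import Algebra.Definitions.RawSemiring as RawSemiringDefs
open import Data.Bool.Base using (if_then_else_)
open import Data.Integer.Base as ℤ using (ℤ; +_; 0ℤ; 1ℤ)
open import Data.List.Base using (List; []; _∷_; map)
open import Data.Nat.Base as ℕ using (ℕ; zero; suc; _∸_; ⌊_/2⌋)
open import Data.Nat.Divisibility using (_∣?_)
open import Level using (0ℓ)
open import Relation.Binary.PropositionalEquality.Core using (_≡_)
open import Relation.Nullary.Decidable.Core using (does)

infix  4 _≈_
infixl 6 _+_
infixl 7 _*_

-- Polynomials in q with integer coefficients, constant term first.
-- Trailing zeros are allowed, so the equality of polynomials is _≈_, not _≡_.
ℤ[q] : Set
ℤ[q] = List ℤ

coeff : ℤ[q] → ℕ → ℤ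
coeff []      _       = 0ℤ
coeff (c ∷ p) zero    = c
coeff (c ∷ p) (suc k) = coeff p k

-- A record rather than a bare function type, so that p and r can be
-- inferred from a proof of p ≈ r.
record _≈_ (p r : ℤ[q]) : Set where
  constructor mk≈
  field
    coeff-≡ : ∀ k → coeff p k ≡ coeff r k

open _≈_ public

_+_ : ℤ[q] → ℤ[q] → ℤ[q]
[]      + r       = r
(c ∷ p) + []      = c ∷ p
(c ∷ p) + (d ∷ r) = (c ℤ.+ d) ∷ (p + r)

_*_ : ℤ[q] → ℤ[q] → ℤ[q]
[]      * r = []
(c ∷ p) * r = map (c ℤ.*_) r + (0ℤ ∷ p * r)

ℤ[q]-rawSemiring : RawSemiring 0ℓ 0ℓ
ℤ[q]-rawSemiring = record
  { Carrier = ℤ[q]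
  ; _≈_     = _≈_
  ; _+_     = _+_
  ; _*_     = _*_
  ; 0#      = []
  ; 1#      = 1ℤ ∷ []
  }

open RawSemiring ℤ[q]-rawSemiring public using (0#; 1#)
open RawSemiringDefs ℤ[q]-rawSemiring public using (_^_)

q : ℤ[q]
q = 0ℤ ∷ 1ℤ ∷ []

const : ℕ → ℤ[q]
const c = (+ c) ∷ []

-- Only needed at non-negative arguments, where truncated subtraction agrees
-- with integer subtraction; the same goes for 1 ∸ ξ k below.
ξ : ℕ → ℕ
ξ n = n ∸ 2 ℕ.* ⌊ n /2⌋

-- In the recursive clauses the index is 2 + n, so the exponent index − 2 is n.
F : (a b : ℕ) → ℕ → ℤ[q]
F a b zero          = 0#
F a b (suc zero)    = 1#
F a b (suc (suc n)) =
  if does (2 ∣? suc (suc n))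
  then const a * F a b (suc n) + q ^ n * F a b n
  else const b * F a b (suc n) + q ^ n * F a b n

F⁽_⁾ : (s : ℕ) (a b : ℕ) → ℕ → ℤ[q]
F⁽ s ⁾ a b zero          = 0#
F⁽ s ⁾ a b (suc zero)    = 1#
F⁽ s ⁾ a b (suc (suc n)) =
  if does (2 ∣? suc (suc n))
  then const (a ℕ.^ ξ (s ℕ.+ 1) ℕ.* b ℕ.^ (1 ∸ ξ (s ℕ.+ 1))) * F⁽ s ⁾ a b (suc n)
         + q ^ (n ℕ.+ s) * F⁽ s ⁾ a b n
  else const (a ℕ.^ (1 ∸ ξ (s ℕ.+ 1)) ℕ.* b ℕ.^ ξ (s ℕ.+ 1)) * F⁽ s ⁾ a b (suc n)
         + q ^ (n ℕ.+ s) * F⁽ s ⁾ a b n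

{-# OPTIONS --safe #-}
-- For fixed m, both sides are sequences in n satisfying the recurrence
-- u (2 + n) = c (3 + n + m) u (1 + n) + q^(1 + n + m) u n, where c k is a for
-- even k and b for odd k: shifting by s turns the coefficient c n into c (n + s).
-- They agree at n = 0 and n = 1, hence everywhere.
module Submission where

open import Algebra.Bundles using (CommutativeSemiring)
open import Algebra.Structures using (IsCommutativeMonoid)
import Algebra.Solver.Ring.NaturalCoefficients.Default as SemiringSolver
open import Algebra.Structures.Biased using (isCommutativeMonoidˡ; isCommutativeSemiringˡ)
open import Data.Bool.Base using (if_then_else_)
open import Data.Bool.Properties using (if-float)
open import Data.Integer.Base as ℤ using (ℤ; 0ℤ; 1ℤ)
import Data.Integer.Properties as ℤ
open import Data.List.Base using ([]; _∷_; map)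
open import Defs
open import Data.Nat.Base as ℕ using (ℕ; zero; suc; NonZero; _∸_; ⌊_/2⌋)
open import Data.Nat.Divisibility using (_∣?_)
import Data.Nat.Properties as ℕ
open import Level using (0ℓ)
open import Relation.Binary.Bundles using (Setoid)
open import Relation.Binary.PropositionalEquality
  using (_≡_; refl; sym; trans; cong; cong₂; module ≡-Reasoning)
import Relation.Binary.Reasoning.Setoid as SetoidReasoning
open import Relation.Binary.Structures using (IsEquivalence)
open import Relation.Nullary.Decidable.Core using (does)

-- Coefficientwise equality and addition of polynomials.

≈-isEquivalence : IsEquivalence _≈_
≈-isEquivalence = record
  { refl  = mk≈ λ _ → refl
  ; sym   = λ e → mk≈ λ k → sym (coeff-≡ e k)
  ; trans = λ e f → mk≈ λ k → trans (coeff-≡ e k) (coeff-≡ f k)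
  }

open IsEquivalence ≈-isEquivalence
  using () renaming (refl to ≈-refl; sym to ≈-sym; trans to ≈-trans)

≈-setoid : Setoid 0ℓ 0ℓ
≈-setoid = record { isEquivalence = ≈-isEquivalence }

infixr 8 _·_

-- Names the `map` in the clause of `_*_`, which then reads `c · r + (0ℤ ∷ p * r)`; prepending `0ℤ`
-- is multiplication by `q`.
_·_ : ℤ → ℤ[q] → ℤ[q]
c · p = map (c ℤ.*_) p

coeff-+ : ∀ p r k → coeff (p + r) k ≡ coeff p k ℤ.+ coeff r k
coeff-+ []      r       k       = sym (ℤ.+-identityˡ _)
coeff-+ (c ∷ p) []      k       = sym (ℤ.+-identityʳ _)
coeff-+ (c ∷ p) (d ∷ r) zero    = refl
coeff-+ (c ∷ p) (d ∷ r) (suc k) = coeff-+ p r k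

coeff-· : ∀ c p k → coeff (c · p) k ≡ c ℤ.* coeff p k
coeff-· c []      k       = sym (ℤ.*-zeroʳ c)
coeff-· c (d ∷ p) zero    = refl
coeff-· c (d ∷ p) (suc k) = coeff-· c p k

∷-cong : ∀ {c d p r} → c ≡ d → p ≈ r → c ∷ p ≈ d ∷ r
∷-cong c≡d p≈r = mk≈ λ { zero → c≡d ; (suc k) → coeff-≡ p≈r k }

0∷[]≈[] : 0ℤ ∷ [] ≈ []
0∷[]≈[] = mk≈ λ { zero → refl ; (suc k) → refl }

-- Equal polynomials may be lists of different lengths, so the proof compares coefficients instead
-- of recursing on the lists.
+-cong : ∀ {p p′ r r′} → p ≈ p′ → r ≈ r′ → p + r ≈ p′ + r′
+-cong {p} {p′} {r} {r′} e f = mk≈ λ k → begin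
  coeff (p + r) k              ≡⟨ coeff-+ p r k ⟩
  coeff p k ℤ.+ coeff r k      ≡⟨ cong₂ ℤ._+_ (coeff-≡ e k) (coeff-≡ f k) ⟩
  coeff p′ k ℤ.+ coeff r′ k    ≡⟨ coeff-+ p′ r′ k ⟨
  coeff (p′ + r′) k            ∎
  where open ≡-Reasoning

+-congˡ : ∀ p {r s} → r ≈ s → p + r ≈ p + s
+-congˡ p = +-cong (≈-refl {p})

+-assoc : ∀ p r s → (p + r) + s ≈ p + (r + s)
+-assoc []      r       s       = ≈-refl
+-assoc (c ∷ p) []      s       = ≈-refl
+-assoc (c ∷ p) (d ∷ r) []      = ≈-refl
+-assoc (c ∷ p) (d ∷ r) (e ∷ s) = ∷-cong (ℤ.+-assoc c d e) (+-assoc p r s)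

+-comm : ∀ p r → p + r ≈ r + p
+-comm []      []      = ≈-refl
+-comm []      (d ∷ r) = ≈-refl
+-comm (c ∷ p) []      = ≈-refl
+-comm (c ∷ p) (d ∷ r) = ∷-cong (ℤ.+-comm c d) (+-comm p r)

+-isCommutativeMonoid : IsCommutativeMonoid _≈_ _+_ []
+-isCommutativeMonoid = isCommutativeMonoidˡ record
  { isSemigroup = record
    { isMagma = record { isEquivalence = ≈-isEquivalence ; ∙-cong = +-cong }
    ; assoc   = +-assoc
    }
  ; identityˡ = λ _ → ≈-refl
  ; comm      = +-comm
  }

+-identityʳ : ∀ p → p + [] ≈ p
+-identityʳ = IsCommutativeMonoid.identityʳ +-isCommutativeMonoid

+-leftComm : ∀ p r s → p + (r + s) ≈ r + (p + s)
+-leftComm p r s = begin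
  p + (r + s)  ≈⟨ +-assoc p r s ⟨
  (p + r) + s  ≈⟨ +-cong (+-comm p r) (≈-refl {s}) ⟩
  (r + p) + s  ≈⟨ +-assoc r p s ⟩
  r + (p + s)  ∎
  where open SetoidReasoning ≈-setoid

+-interchange : ∀ p r s t → (p + r) + (s + t) ≈ (p + s) + (r + t)
+-interchange p r s t = begin
  (p + r) + (s + t)  ≈⟨ +-assoc p r (s + t) ⟩
  p + (r + (s + t))  ≈⟨ +-congˡ p (+-leftComm r s t) ⟩
  p + (s + (r + t))  ≈⟨ +-assoc p s (r + t) ⟨
  (p + s) + (r + t)  ∎
  where open SetoidReasoning ≈-setoid

-- Scalar multiples, products and the semiring laws.

·-congˡ : ∀ c {p r} → p ≈ r → c · p ≈ c · r
·-congˡ c {p} {r} e = mk≈ λ k → begin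
  coeff (c · p) k    ≡⟨ coeff-· c p k ⟩
  c ℤ.* coeff p k    ≡⟨ cong (c ℤ.*_) (coeff-≡ e k) ⟩
  c ℤ.* coeff r k    ≡⟨ coeff-· c r k ⟨
  coeff (c · r) k    ∎
  where open ≡-Reasoning

·-distribˡ-+ : ∀ c p r → c · (p + r) ≈ c · p + c · r
·-distribˡ-+ c []      r       = ≈-refl
·-distribˡ-+ c (d ∷ p) []      = ≈-refl
·-distribˡ-+ c (d ∷ p) (e ∷ r) = ∷-cong (ℤ.*-distribˡ-+ c d e) (·-distribˡ-+ c p r)

·-assoc : ∀ c d p → (c ℤ.* d) · p ≈ c · d · p
·-assoc c d []      = ≈-refl
·-assoc c d (e ∷ p) = ∷-cong (ℤ.*-assoc c d e) (·-assoc c d p)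

·-identityˡ : ∀ p → 1ℤ · p ≈ p
·-identityˡ []      = ≈-refl
·-identityˡ (c ∷ p) = ∷-cong (ℤ.*-identityˡ c) (·-identityˡ p)

·-zeroˡ : ∀ p → 0ℤ · p ≈ []
·-zeroˡ []      = ≈-refl
·-zeroˡ (c ∷ p) = ≈-trans (∷-cong refl (·-zeroˡ p)) 0∷[]≈[]

*-congˡ : ∀ p {r s} → r ≈ s → p * r ≈ p * s
*-congˡ []      e = ≈-refl
*-congˡ (c ∷ p) e = +-cong (·-congˡ c e) (∷-cong refl (*-congˡ p e))

*-zeroʳ : ∀ p → p * [] ≈ []
*-zeroʳ []      = ≈-refl
*-zeroʳ (c ∷ p) = ≈-trans (∷-cong refl (*-zeroʳ p)) 0∷[]≈[]

-- Mirrors the defining clause of `_*_` in the right factor, as the inductive step of commutativity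
-- requires.
*-∷ : ∀ p c r → p * (c ∷ r) ≈ c · p + (0ℤ ∷ p * r)
*-∷ []      c r = ≈-sym 0∷[]≈[]
*-∷ (d ∷ p) c r = ∷-cong (cong (ℤ._+ 0ℤ) (ℤ.*-comm d c)) (begin
  d · r + p * (c ∷ r)               ≈⟨ +-congˡ (d · r) (*-∷ p c r) ⟩
  d · r + (c · p + (0ℤ ∷ p * r))    ≈⟨ +-leftComm (d · r) (c · p) (0ℤ ∷ p * r) ⟩
  c · p + (d · r + (0ℤ ∷ p * r))    ∎)
  where open SetoidReasoning ≈-setoid

*-comm : ∀ p r → p * r ≈ r * p
*-comm []      r = ≈-sym (*-zeroʳ r)
*-comm (c ∷ p) r =
  ≈-trans (+-congˡ (c · r) (∷-cong refl (*-comm p r))) (≈-sym (*-∷ r c p))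

*-distribˡ-+ : ∀ p r s → p * (r + s) ≈ p * r + p * s
*-distribˡ-+ []      r s = ≈-refl
*-distribˡ-+ (c ∷ p) r s = begin
  c · (r + s) + (0ℤ ∷ p * (r + s))
    ≈⟨ +-cong (·-distribˡ-+ c r s) (∷-cong refl (*-distribˡ-+ p r s)) ⟩
  (c · r + c · s) + ((0ℤ ∷ p * r) + (0ℤ ∷ p * s))
    ≈⟨ +-interchange (c · r) (c · s) (0ℤ ∷ p * r) (0ℤ ∷ p * s) ⟩
  (c ∷ p) * r + (c ∷ p) * s ∎
  where open SetoidReasoning ≈-setoid

-- `_*_` recurses on its left factor, so `*-congˡ` replaces the right one by induction;
-- commutativity brings the left factor into that position.
*-cong : ∀ {p p′ r r′} → p ≈ p′ → r ≈ r′ → p * r ≈ p′ * r′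
*-cong {p} {p′} {r} {r′} e f = begin
  p * r    ≈⟨ *-congˡ p f ⟩
  p * r′   ≈⟨ *-comm p r′ ⟩
  r′ * p   ≈⟨ *-congˡ r′ e ⟩
  r′ * p′  ≈⟨ *-comm r′ p′ ⟩
  p′ * r′  ∎
  where open SetoidReasoning ≈-setoid

*-distribʳ-+ : ∀ s p r → (p + r) * s ≈ p * s + r * s
*-distribʳ-+ s p r = begin
  (p + r) * s    ≈⟨ *-comm (p + r) s ⟩
  s * (p + r)    ≈⟨ *-distribˡ-+ s p r ⟩
  s * p + s * r  ≈⟨ +-cong (*-comm s p) (*-comm s r) ⟩
  p * s + r * s  ∎
  where open SetoidReasoning ≈-setoid

-- Handles the leading coefficient in the induction for `*-assoc`.
·-*-assoc : ∀ c p r → (c · p) * r ≈ c · (p * r)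
·-*-assoc c []      r = ≈-refl
·-*-assoc c (d ∷ p) r = begin
  (c ℤ.* d) · r + (0ℤ ∷ (c · p) * r)
    -- The leading zero becomes `c ℤ.* 0ℤ`, which makes the whole shifted list a multiple by `c`.
    ≈⟨ +-cong (·-assoc c d r) (∷-cong (sym (ℤ.*-zeroʳ c)) (·-*-assoc c p r)) ⟩
  c · d · r + c · (0ℤ ∷ p * r)
    ≈⟨ ·-distribˡ-+ c (d · r) (0ℤ ∷ p * r) ⟨
  c · (d · r + (0ℤ ∷ p * r)) ∎
  where open SetoidReasoning ≈-setoid

*-assoc : ∀ p r s → (p * r) * s ≈ p * (r * s)
*-assoc []      r s = ≈-refl
*-assoc (c ∷ p) r s = begin
  (c · r + (0ℤ ∷ p * r)) * s
    ≈⟨ *-distribʳ-+ s (c · r) (0ℤ ∷ p * r) ⟩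
  (c · r) * s + (0ℤ · s + (0ℤ ∷ (p * r) * s))
    -- `0ℤ · s` is a list of zeros; once replaced by `[]` it disappears, since `[] + r` computes to
    -- `r`.
    ≈⟨ +-cong (·-*-assoc c r s) (+-cong (·-zeroˡ s) (∷-cong refl (*-assoc p r s))) ⟩
  c · (r * s) + (0ℤ ∷ p * (r * s)) ∎
  where open SetoidReasoning ≈-setoid

*-identityˡ : ∀ p → 1# * p ≈ p
*-identityˡ p = begin
  1ℤ · p + (0ℤ ∷ [])  ≈⟨ +-cong (·-identityˡ p) 0∷[]≈[] ⟩
  p + []              ≈⟨ +-identityʳ p ⟩
  p                   ∎
  where open SetoidReasoning ≈-setoid

*-isCommutativeMonoid : IsCommutativeMonoid _≈_ _*_ 1#
*-isCommutativeMonoid = isCommutativeMonoidˡ record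
  { isSemigroup = record
    { isMagma = record { isEquivalence = ≈-isEquivalence ; ∙-cong = *-cong }
    ; assoc   = *-assoc
    }
  ; identityˡ = *-identityˡ
  ; comm      = *-comm
  }

ℤ[q]-commutativeSemiring : CommutativeSemiring 0ℓ 0ℓ
ℤ[q]-commutativeSemiring = record
  { isCommutativeSemiring = isCommutativeSemiringˡ record
    { +-isCommutativeMonoid = +-isCommutativeMonoid
    ; *-isCommutativeMonoid = *-isCommutativeMonoid
    ; distribʳ              = *-distribʳ-+
    ; zeroˡ                 = λ _ → ≈-refl
    }
  }

-- The recurrences and the addition formula.

module _ {c ℓ} (R : CommutativeSemiring c ℓ) where
  private module R = CommutativeSemiring R
  open SemiringSolver R

  -- Lets a fixed combination of two solutions inherit their common recurrence. Over an abstract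
  -- semiring the operations do not unfold.
  recurrence-linear : ∀ w t x y u₁ u₀ v₁ v₀ →
    (w R.* (x R.* u₁ R.+ y R.* v₁) R.+ t R.* (x R.* u₀ R.+ y R.* v₀))
      R.≈ (x R.* (w R.* u₁ R.+ t R.* u₀) R.+ y R.* (w R.* v₁ R.+ t R.* v₀))
  recurrence-linear = solve 8 (λ w t x y u₁ u₀ v₁ v₀ →
    w :* (x :* u₁ :+ y :* v₁) :+ t :* (x :* u₀ :+ y :* v₀)
      := x :* (w :* u₁ :+ t :* u₀) :+ y :* (w :* v₁ :+ t :* v₀)) R.refl

-- After `2 * suc ⌊ n /2⌋` is expanded, truncated subtraction cancels the two successors by
-- computation.
ξ-2+ : ∀ n → ξ (2 ℕ.+ n) ≡ ξ n
ξ-2+ n = cong (2 ℕ.+ n ∸_) (ℕ.*-suc 2 ⌊ n /2⌋)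

module _ (a b : ℕ) where

  -- The coefficient for index `2 + n`, read at `n`, which has the same parity.
  weight : ℕ → ℤ[q]
  weight n = if does (2 ∣? n) then const a else const b

  shiftedWeight : ℕ → ℕ → ℤ[q]
  shiftedWeight s n =
    if does (2 ∣? n)
    then const (a ℕ.^ ξ (s ℕ.+ 1) ℕ.* b ℕ.^ (1 ∸ ξ (s ℕ.+ 1)))
    else const (a ℕ.^ (1 ∸ ξ (s ℕ.+ 1)) ℕ.* b ℕ.^ ξ (s ℕ.+ 1))

  x^1*y^0≡x : ∀ x y → x ℕ.^ 1 ℕ.* y ℕ.^ 0 ≡ x
  x^1*y^0≡x x y = trans (ℕ.*-identityʳ (x ℕ.^ 1)) (ℕ.^-identityʳ x)

  x^0*y^1≡y : ∀ x y → x ℕ.^ 0 ℕ.* y ℕ.^ 1 ≡ y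
  x^0*y^1≡y x y = trans (ℕ.*-identityˡ (y ℕ.^ 1)) (ℕ.^-identityʳ y)

  -- does (2 ∣? 2 + n) computes to does (2 ∣? n), so induction in steps of two
  -- needs no parity lemma.
  shiftedWeight≡weight : ∀ s n → shiftedWeight s n ≡ weight (n ℕ.+ s)
  shiftedWeight≡weight s             (suc (suc n)) = shiftedWeight≡weight s n
  shiftedWeight≡weight zero          zero          = cong const (x^1*y^0≡x a b)
  shiftedWeight≡weight zero          (suc zero)    = cong const (x^0*y^1≡y a b)
  shiftedWeight≡weight (suc zero)    zero          = cong const (x^0*y^1≡y a b)
  shiftedWeight≡weight (suc zero)    (suc zero)    = cong const (x^1*y^0≡x a b)
  shiftedWeight≡weight (suc (suc s)) zero
    rewrite ξ-2+ (s ℕ.+ 1) = shiftedWeight≡weight s zero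
  shiftedWeight≡weight (suc (suc s)) (suc zero)
    rewrite ξ-2+ (s ℕ.+ 1) = shiftedWeight≡weight s (suc zero)

  -- `F` chooses between two whole sums; `if-float` moves the choice into the coefficient, so one
  -- equation serves both parities.
  F-recurrence : ∀ n →
    F a b (2 ℕ.+ n) ≡ weight n * F a b (1 ℕ.+ n) + q ^ n * F a b n
  F-recurrence n =
    sym (if-float (λ w → w * F a b (1 ℕ.+ n) + q ^ n * F a b n) (does (2 ∣? n)))

  -- Weight and exponent depend only on `n + s`, so `F⁽ m ⁾` one index ahead and `F⁽ suc m ⁾` obey
  -- the same recurrence.
  F⁽⁾-recurrence : ∀ s n →
    F⁽ s ⁾ a b (2 ℕ.+ n)
      ≡ weight (n ℕ.+ s) * F⁽ s ⁾ a b (1 ℕ.+ n) + q ^ (n ℕ.+ s) * F⁽ s ⁾ a b n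
  F⁽⁾-recurrence s n = trans
    (sym (if-float step (does (2 ∣? n))))
    (cong step (shiftedWeight≡weight s n))
    where
    step : ℤ[q] → ℤ[q]
    step w = w * F⁽ s ⁾ a b (1 ℕ.+ n) + q ^ (n ℕ.+ s) * F⁽ s ⁾ a b n

  -- The recurrence has order two, hence two base cases. With `suc` outermost, the indices reduce as
  -- `n` is split.
  F-addition : ∀ n m →
    F a b (suc (n ℕ.+ m))
      ≈ F a b (suc m) * F⁽ m ⁾ a b (suc n) + q ^ m * F a b m * F⁽ suc m ⁾ a b n
  F-addition zero m = begin
    F a b (suc m)                                    ≈⟨ *-identityʳ (F a b (suc m)) ⟨
    F a b (suc m) * 1#                               ≈⟨ +-identityʳ _ ⟨
    F a b (suc m) * 1# + []
      ≈⟨ +-congˡ (F a b (suc m) * 1#) (*-zeroʳ (q ^ m * F a b m)) ⟨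
    F a b (suc m) * 1# + q ^ m * F a b m * []        ∎
    where
    open SetoidReasoning ≈-setoid
    open CommutativeSemiring ℤ[q]-commutativeSemiring using (*-identityʳ)
  -- `F⁽ m ⁾` at index 2 is `weight m`, so this case is the recurrence of `F` at index `2 + m`.
  F-addition (suc zero) m = begin
    F a b (2 ℕ.+ m)
      ≡⟨ F-recurrence m ⟩
    weight m * F a b (suc m) + q ^ m * F a b m
      ≈⟨ +-cong (*-comm (weight m) (F a b (suc m))) (≈-sym (*-identityʳ (q ^ m * F a b m))) ⟩
    F a b (suc m) * weight m + q ^ m * F a b m * 1#
      ≈⟨ +-cong (*-congˡ (F a b (suc m)) F⁽m⁾₂) (≈-refl {q ^ m * F a b m * 1#}) ⟨
    F a b (suc m) * F⁽ m ⁾ a b 2 + q ^ m * F a b m * 1# ∎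
    where
    open SetoidReasoning ≈-setoid
    open CommutativeSemiring ℤ[q]-commutativeSemiring using (*-identityʳ)
    F⁽m⁾₂ : F⁽ m ⁾ a b 2 ≈ weight m
    F⁽m⁾₂ = begin
      F⁽ m ⁾ a b 2                     ≡⟨ F⁽⁾-recurrence m 0 ⟩
      weight m * 1# + q ^ m * []       ≈⟨ +-cong (*-identityʳ (weight m)) (*-zeroʳ (q ^ m)) ⟩
      weight m + []                    ≈⟨ +-identityʳ (weight m) ⟩
      weight m                         ∎
  F-addition (suc (suc n)) m = begin
    F a b (3 ℕ.+ n ℕ.+ m)
      ≡⟨ F-recurrence (suc (n ℕ.+ m)) ⟩
    w * F a b (2 ℕ.+ n ℕ.+ m) + t * F a b (suc (n ℕ.+ m))
      ≈⟨ +-cong (*-congˡ w (F-addition (suc n) m)) (*-congˡ t (F-addition n m)) ⟩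
    w * (x * F⁽ m ⁾ a b (2 ℕ.+ n) + y * F⁽ suc m ⁾ a b (suc n))
      + t * (x * F⁽ m ⁾ a b (suc n) + y * F⁽ suc m ⁾ a b n)
      ≈⟨ recurrence-linear ℤ[q]-commutativeSemiring w t x y _ _ _ _ ⟩
    x * (w * F⁽ m ⁾ a b (2 ℕ.+ n) + t * F⁽ m ⁾ a b (suc n))
      + y * (w * F⁽ suc m ⁾ a b (suc n) + t * F⁽ suc m ⁾ a b n)
      ≡⟨ cong₂ (λ u v → x * u + y * v) (F⁽⁾-recurrence m (suc n)) F⁽suc-m⁾ ⟨
    x * F⁽ m ⁾ a b (3 ℕ.+ n) + y * F⁽ suc m ⁾ a b (2 ℕ.+ n) ∎
    where
    open SetoidReasoning ≈-setoid
    w t x y : ℤ[q]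
    w = weight (suc (n ℕ.+ m))
    t = q ^ suc (n ℕ.+ m)
    x = F a b (suc m)
    y = q ^ m * F a b m
    F⁽suc-m⁾ : F⁽ suc m ⁾ a b (2 ℕ.+ n)
      ≡ w * F⁽ suc m ⁾ a b (suc n) + t * F⁽ suc m ⁾ a b n
    -- Here the recurrence yields `n + suc m`, which must be rewritten to `suc (n + m)`; for
    -- `F⁽ m ⁾` the index `suc n + m` reduces to it by computation.
    F⁽suc-m⁾ = trans (F⁽⁾-recurrence (suc m) n)
      (cong (λ k → weight k * F⁽ suc m ⁾ a b (suc n) + q ^ k * F⁽ suc m ⁾ a b n)
        (ℕ.+-suc n m))

theorem15 : (a b : ℕ) .{{_ : NonZero a}} .{{_ : NonZero b}} (n m : ℕ) →
    F a b (n ℕ.+ m ℕ.+ 1)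
    ≈ F a b (m ℕ.+ 1) * F⁽ m ⁾ a b (n ℕ.+ 1)
    + q ^ m * F a b m * F⁽ m ℕ.+ 1 ⁾ a b n
-- `_+ 1` is stuck on a variable, so each occurrence is turned into `suc`.
theorem15 a b n m
  rewrite ℕ.+-comm (n ℕ.+ m) 1 | ℕ.+-comm m 1 | ℕ.+-comm n 1 = F-addition a b n m
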